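{- Let $n\ge 2$ and $m=n-1$. Let $P_1,\dots,P_r$ be self-matched legs (with respect to $n$), all rooted at the common hub label $1$. Suppose that their non-hub label sets are pairwise disjoint and that at least one of these sets contains $0$. Form a spider tree whose hub has label $1$ by attaching the paths $P_1,\dots,P_r$ as arms at the hub, and attaching every unused non-hub label (every element of $A_n=\{0,2,3,\dots,m\}$ not occurring on any $P_i$) as a leaf adjacent to the hub. Then the resulting labeling of this spider tree is graceful.
   Context: A graceful labeling of a tree with $n$ vertices is a bijection from its vertices to $\{0,1,\dots,n-1\}$ such that the set of absolute differences of the labels of adjacent vertices equals $\{1,2,\dots,n-1\}$. A spider tree is obtained from a central hub vertex by attaching paths, called arms, at the hub. Put $m=n-1$ and $A_n=\{0,2,3,\dots,m\}$ (the non-hub labels when the hub has label $1$). Define $\tau_n:A_n\to\{1,\dots,m\}$ by $\tau_n(0)=m$ and $\tau_n(x)=x-1$ for $x\ge2$. A self-matched leg (with respect to $n$) is a rooted label path $P=(1,x_1,x_2,\dots,x_L)$ with distinct $x_i\in A_n$ such that $$\{|1-x_1|,|x_1-x_2|,\dots,|x_{L-1}-x_L|\}=\tau_n(\{x_1,\dots,x_L\}).$$ Its non-hub label set is $\{x_1,\dots,x_L\}$. Attaching $P$ as an arm at the hub means attaching a path of $L$ edges whose vertices, starting from the hub, are labeled $1,x_1,\dots,x_L$. -}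

module Defs where

open import Data.Fin.Base using (Fin; toℕ)
open import Data.List.Base
  using (List; []; _∷_; [_]; _++_; _∷ʳ_; map; filter; concat; length; lookup; zipWith; applyUpTo)
open import Data.List.Membership.DecPropositional using (_∈?_)
open import Data.List.Membership.Propositional using (_∈_)
open import Data.List.Relation.Binary.BagAndSetEquality using (_∼[_]_; set)
open import Data.List.Relation.Unary.All using (All)
open import Data.List.Relation.Unary.Linked using (Linked)
open import Data.List.Relation.Unary.Unique.Propositional using (Unique)
open import Data.Nat.Base using (ℕ; zero; suc; _∸_; _≤_; _<_; ∣_-_∣)
open import Data.Nat.Properties using (_≟_; 1+n≢n)
open import Data.Product.Base using (_×_; ∃; ∃₂)
open import Function.Definitions using (Injective)
open import Level using (0ℓ)
open import Relation.Binary.Construct.Closure.ReflexiveTransitive using (Star)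
open import Relation.Binary.Construct.Closure.Symmetric using (SymClosure; fwd; bwd; symmetric)
open import Relation.Binary.Core using (Rel)
open import Relation.Binary.Definitions using (Symmetric)
open import Relation.Binary.PropositionalEquality using (_≡_; sym)
open import Relation.Nullary using (¬_; ¬?)
open import Relation.Unary using (_≐_)

record Graph : Set₁ where
  infix 4 _~_
  field
    Vertex   : Set
    _~_      : Rel Vertex 0ℓ
    ~-sym    : Symmetric _~_
    ~-irrefl : ∀ {v} → ¬ v ~ v

module _ (G : Graph) where
  open Graph G

  -- The cycle v, vs₁, …, vsₖ, v, which has at least three vertices.
  record IsCycle (v : Vertex) (vs : List Vertex) : Set where
    field
      long     : 2 ≤ length vs
      distinct : Unique (v ∷ vs)
      closed   : Linked _~_ (v ∷ vs ∷ʳ v)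

  record IsTree : Set where
    field
      connected : ∀ u v → Star _~_ u v
      acyclic   : ∀ v vs → ¬ IsCycle v vs

  -- Gracefulness is a notion for trees, so being a tree is one of its clauses.
  -- The bijection onto {0, …, n - 1} is an injection with that image; hence
  -- the tree has exactly n vertices.
  record IsGracefulLabeling (n : ℕ) (f : Vertex → ℕ) : Set where
    field
      isTree      : IsTree
      injective   : Injective _≡_ _≡_ f
      labels      : (λ k → ∃ λ v → k ≡ f v) ≐ (λ k → k < n)
      differences : (λ d → ∃₂ λ u v → u ~ v × d ≡ ∣ f u - f v ∣)
                      ≐ (λ d → 1 ≤ d × d ≤ n ∸ 1)

-- The spider with r arms, the i-th of which has len i edges.

module _ {r : ℕ} (len : Fin r → ℕ) where

  -- at i j is the vertex of the i-th arm at distance 1 + toℕ j from the hub.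
  data SpiderVertex : Set where
    hub : SpiderVertex
    at  : (i : Fin r) → Fin (len i) → SpiderVertex

  data Child : Rel SpiderVertex 0ℓ where
    first : ∀ {i j} → toℕ j ≡ 0 → Child hub (at i j)
    next  : ∀ {i j k} → toℕ k ≡ suc (toℕ j) → Child (at i j) (at i k)

  Child-irrefl : ∀ {v} → ¬ Child v v
  Child-irrefl (next eq) = 1+n≢n (sym eq)

  spider : Graph
  spider = record
    { Vertex   = SpiderVertex
    ; _~_      = SymClosure Child
    ; ~-sym    = symmetric Child
    ; ~-irrefl = λ { (fwd c) → Child-irrefl c ; (bwd c) → Child-irrefl c }
    }

-- A spider labeled with hub label 1 is given by the list of its arms, each arm
-- being the list of its non-hub labels read outwards from the hub.

armLength : (arms : List (List ℕ)) → Fin (length arms) → ℕ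
armLength arms i = length (lookup arms i)

labeling : (arms : List (List ℕ)) → SpiderVertex (armLength arms) → ℕ
labeling arms hub      = 1
labeling arms (at i j) = lookup (lookup arms i) j

-- The set {0, 2, 3, …, n - 1}, for n ≥ 2.
A : ℕ → List ℕ
A n = 0 ∷ applyUpTo (λ k → suc (suc k)) (n ∸ 2)

-- Only meaningful on A n; the value at 1 is junk.
τ : ℕ → ℕ → ℕ
τ n zero    = n ∸ 1
τ n (suc x) = x

-- The leg (1, x₁, …, x_L) is represented by xs = [x₁, …, x_L]; zipping 1 ∷ xs
-- with xs then runs over the pairs (1, x₁), (x₁, x₂), …, (x_{L-1}, x_L).
record IsSelfMatchedLeg (n : ℕ) (xs : List ℕ) : Set where
  field
    distinct    : Unique xs
    inA         : All (_∈ A n) xs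
    selfMatched : zipWith ∣_-_∣ (1 ∷ xs) xs ∼[ set ] map (τ n) xs

unused : ℕ → List (List ℕ) → List ℕ
unused n Ps = filter (λ x → ¬? (_∈?_ _≟_ x (concat Ps))) (A n)

-- The legs together with the unused labels as arms of length one.
attach : ℕ → List (List ℕ) → List (List ℕ)
attach n Ps = Ps ++ map [_] (unused n Ps)

{-# OPTIONS --safe #-}

-- As 0 lies on some leg, every unused label x is at least 2, and then [x] is
-- itself a self-matched leg, because |1 - x| = τ x. So all arms of the spider are
-- self-matched, and since they partition A n, the edge differences are exactly the
-- values of τ on A n, that is 1, …, n - 1.

module Submission where

open import Defs
open import Data.Empty using (⊥-elim)
open import Data.Fin.Base using (Fin; zero; suc; toℕ; fromℕ<)
open import Data.Fin.Properties using (toℕ-fromℕ<; toℕ-injective; toℕ<n)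
open import Data.List.Base using (List; []; _∷_; [_]; _∷ʳ_; concat; length; lookup; map; zipWith)
open import Data.List.Membership.DecPropositional using (_∈?_)
open import Data.List.Membership.Propositional using (_∈_; find; lose)
open import Data.List.Membership.Propositional.Properties
  using (∈-lookup; ∈-concat⁺; ∈-concat⁻; ∈-filter⁺; ∈-filter⁻; ∈-map⁺; ∈-map⁻; ∈-applyUpTo⁺; ∈-applyUpTo⁻)
open import Data.List.Relation.Binary.Disjoint.Propositional using (Disjoint)
open import Data.List.Relation.Unary.All as All using (All; []; _∷_)
import Data.List.Relation.Unary.All.Properties as All
open import Data.List.Relation.Unary.AllPairs as AllPairs using (AllPairs; []; _∷_)
import Data.List.Relation.Unary.AllPairs.Properties as AllPairs
open import Data.List.Relation.Unary.Any as Any using (Any; here; there; index)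
import Data.List.Relation.Unary.Any.Properties as Any
open import Data.List.Relation.Unary.Linked using (Linked; _∷_)
open import Data.List.Relation.Unary.Unique.Propositional using (Unique)
import Data.List.Relation.Unary.Unique.Propositional.Properties as Unique
open import Data.Nat.Base using (ℕ; zero; suc; _≤_; _<_; _∸_; z≤n; s≤s; s≤s⁻¹; ∣_-_∣)
open import Data.Nat.Properties
  using (_≟_; 0≢1+n; <-asym; <-irrefl; <-trans; <⇒≤; ≤-refl; ≤-reflexive; ≤∧≢⇒<; suc-injective; ∣-∣-comm)
open import Data.Product.Base using (_×_; _,_; proj₁; proj₂; ∃; ∃₂)
open import Data.Sum.Base using (_⊎_; inj₁; inj₂)
open import Function.Base using (id; _∘_)
open import Function.Bundles using (mk⇔; module Equivalence)
open import Relation.Binary.Construct.Closure.ReflexiveTransitive using (Star; ε; _◅_; _◅◅_; reverse)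
open import Relation.Binary.Construct.Closure.Symmetric using (SymClosure; fwd; bwd; symmetric)
open import Relation.Binary.PropositionalEquality
  using (_≡_; _≢_; refl; sym; trans; cong; subst)
open import Relation.Nullary using (¬_; ¬?; yes; no)

-- Spiders are trees.

module _ {r : ℕ} {len : Fin r → ℕ} where

  private
    V = SpiderVertex len
    _⇒_ = Child len
    _~_ = SymClosure (Child len)

  depth : V → ℕ
  depth hub      = 0
  depth (at _ j) = suc (toℕ j)

  depth-Child : ∀ {u v} → u ⇒ v → depth u < depth v
  depth-Child (first _) = s≤s z≤n
  depth-Child (next eq) = s≤s (≤-reflexive (sym eq))

  -- An index is not both 0 and a successor, so `first` and `next` never lead to the same vertex.
  -- Acyclicity rests on this fact and on the growth of `depth`.
  parent-unique : ∀ {u v w} → u ⇒ w → v ⇒ w → u ≡ v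
  parent-unique (first _)  (first _)  = refl
  parent-unique (first eq) (next eq′) = ⊥-elim (0≢1+n (trans (sym eq) eq′))
  parent-unique (next eq)  (first eq′) = ⊥-elim (0≢1+n (trans (sym eq′) eq))
  parent-unique (next eq)  (next eq′) =
    cong (at _) (toℕ-injective (suc-injective (trans (sym eq) eq′)))

  -- A path that has once moved away from the hub can only continue doing so,
  -- as the only way back is through the vertex just left.
  descent : ∀ {u w z} ys → u ⇒ w → Unique (u ∷ w ∷ ys) → All (z ≢_) (u ∷ w ∷ ys) →
            Linked _~_ (w ∷ ys ∷ʳ z) → depth u < depth z × ∃ λ x → x ∈ w ∷ ys × x ⇒ z
  descent [] c _ _ (fwd d ∷ _) =
    <-trans (depth-Child c) (depth-Child d) , _ , here refl , d
  descent [] c _ (z≢u ∷ _) (bwd d ∷ _) = ⊥-elim (z≢u (parent-unique d c))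
  descent (y ∷ ys) c (_ ∷ uniq) (_ ∷ z∉) (fwd d ∷ walk)
    with lt , x , x∈ , e ← descent ys d uniq z∉ walk =
    <-trans (depth-Child c) lt , x , there x∈ , e
  descent (y ∷ ys) c ((_ ∷ u≢y ∷ _) ∷ _) _ (bwd d ∷ _) = ⊥-elim (u≢y (parent-unique c d))

  -- A path climbs towards the hub until it first turns outwards. If it never turns, its end is
  -- nearer the hub than its start; from the turn on, it behaves as in `descent`.
  ascent-or-descent : ∀ {u z} ys → Unique (u ∷ ys) → All (z ≢_) (u ∷ ys) →
                      Linked _~_ (u ∷ ys ∷ʳ z) →
                      depth z < depth u ⊎ ∃ λ x → x ∈ u ∷ ys × x ⇒ z
  ascent-or-descent [] _ _ (fwd c ∷ _) = inj₂ (_ , here refl , c)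
  ascent-or-descent [] _ _ (bwd c ∷ _) = inj₁ (depth-Child c)
  ascent-or-descent (y ∷ ys) uniq z∉ (fwd c ∷ walk)
    with _ , x , x∈ , d ← descent ys c uniq z∉ walk = inj₂ (x , there x∈ , d)
  ascent-or-descent (y ∷ ys) (_ ∷ uniq) (_ ∷ z∉) (bwd c ∷ walk)
    with ascent-or-descent ys uniq z∉ walk
  ... | inj₁ lt           = inj₁ (<-trans lt (depth-Child c))
  ... | inj₂ (x , x∈ , d) = inj₂ (x , there x∈ , d)

  -- The directions of the first two edges decide. One edge away and one back would revisit `v`; two
  -- edges away force an end deeper than `v`. If the first edge climbs to the parent `a`, then the
  -- cycle either comes back into `v` from `a` a second time or, climbing throughout, ends too near
  -- the hub.
  spider-acyclic : ∀ v vs → ¬ IsCycle (spider len) v vs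
  spider-acyclic v [] record { long = () }
  spider-acyclic v (_ ∷ []) record { long = s≤s () }
  spider-acyclic v (a ∷ b ∷ cs) record { distinct = v∉ ∷ uniq ; closed = fwd c ∷ fwd d ∷ walk } =
    <-asym (depth-Child c) (proj₁ (descent cs d uniq v∉ walk))
  spider-acyclic v (a ∷ b ∷ cs) record { distinct = (_ ∷ v≢b ∷ _) ∷ _ ; closed = fwd c ∷ bwd d ∷ _ } =
    v≢b (parent-unique c d)
  spider-acyclic v (a ∷ b ∷ cs) record { distinct = v∉ ∷ uniq@(a∉ ∷ _) ; closed = bwd c ∷ fwd d ∷ walk }
    with _ , x , x∈ , e ← descent cs d uniq v∉ walk =
    All.lookup a∉ x∈ (parent-unique c e)
  spider-acyclic v (a ∷ b ∷ cs) record { distinct = (_ ∷ v∉) ∷ (a∉ ∷ uniq) ; closed = bwd c ∷ bwd d ∷ walk }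
    with ascent-or-descent cs uniq v∉ walk
  ... | inj₁ lt           = <-asym lt (<-trans (depth-Child d) (depth-Child c))
  ... | inj₂ (x , x∈ , e) = All.lookup a∉ x∈ (parent-unique c e)

  from-hub : ∀ v → Star _~_ hub v
  from-hub hub      = ε
  from-hub (at i j) = go (toℕ j) j refl
    where
    -- The recursion runs on the number `k`, because the predecessor `p` is rebuilt by `fromℕ<` and
    -- is not structurally smaller than `j`.
    go : ∀ k (j : Fin (len i)) → toℕ j ≡ k → Star _~_ hub (at i j)
    go zero    j eq = fwd (first eq) ◅ ε
    go (suc k) j eq =
      go k p p≡k ◅◅ fwd (next (trans eq (cong suc (sym p≡k)))) ◅ ε
      where
      k<len : k < len i
      k<len = <⇒≤ (subst (_< len i) eq (toℕ<n j))
      p : Fin (len i)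
      p = fromℕ< k<len
      p≡k : toℕ p ≡ k
      p≡k = toℕ-fromℕ< k<len

  spider-isTree : IsTree (spider len)
  spider-isTree = record
    { connected = λ u v → reverse (symmetric _) (from-hub u) ◅◅ from-hub v
    ; acyclic   = spider-acyclic
    }

-- Positions in lists, and differences of successive entries.

lookup-injective : ∀ {a} {X : Set a} {xs : List X} → Unique xs →
                   ∀ i j → lookup xs i ≡ lookup xs j → i ≡ j
lookup-injective (_ ∷ _)    zero    zero    _  = refl
lookup-injective (x∉ ∷ _)   zero    (suc j) eq = ⊥-elim (All.lookup x∉ (∈-lookup j) eq)
lookup-injective (x∉ ∷ _)   (suc i) zero    eq = ⊥-elim (All.lookup x∉ (∈-lookup i) (sym eq))
lookup-injective (_ ∷ uniq) (suc i) (suc j) eq = cong suc (lookup-injective uniq i j eq)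

-- A label determines the arm carrying it, so injectivity of the labeling reduces to a single arm.
disjoint-lookup : ∀ {a} {X : Set a} {xss : List (List X)} {x : X} → AllPairs Disjoint xss →
                  ∀ i j → x ∈ lookup xss i → x ∈ lookup xss j → i ≡ j
disjoint-lookup (_ ∷ _)  zero    zero    _ _ = refl
disjoint-lookup (d ∷ _)  zero    (suc j) p q = ⊥-elim (All.lookup d (∈-lookup j) (p , q))
disjoint-lookup (d ∷ _)  (suc i) zero    p q = ⊥-elim (All.lookup d (∈-lookup i) (q , p))
disjoint-lookup (_ ∷ ds) (suc i) (suc j) p q = cong suc (disjoint-lookup ds i j p q)

-- The difference list of `IsSelfMatchedLeg`, with the start 1 generalised to `a` so that inductions
-- can pass to the tail of an arm.
steps : ℕ → List ℕ → List ℕ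
steps a xs = zipWith ∣_-_∣ (a ∷ xs) xs

step-first : ∀ a xs (j : Fin (length xs)) → toℕ j ≡ 0 → ∣ a - lookup xs j ∣ ∈ steps a xs
step-first a (x ∷ xs) zero _ = here refl

step-next : ∀ a xs (j k : Fin (length xs)) → toℕ k ≡ suc (toℕ j) →
            ∣ lookup xs j - lookup xs k ∣ ∈ steps a xs
step-next a (x ∷ xs) zero    (suc k) eq = there (step-first x xs k (suc-injective eq))
step-next a (x ∷ xs) (suc j) (suc k) eq = there (step-next x xs j k (suc-injective eq))

-- The two alternatives mirror the constructors `first` and `next` of `Child`.
∈-steps⁻ : ∀ {d} a xs → d ∈ steps a xs →
           (∃ λ (j : Fin (length xs)) → toℕ j ≡ 0 × d ≡ ∣ a - lookup xs j ∣) ⊎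
           (∃₂ λ (j k : Fin (length xs)) → toℕ k ≡ suc (toℕ j) × d ≡ ∣ lookup xs j - lookup xs k ∣)
∈-steps⁻ a (x ∷ xs) (here eq) = inj₁ (zero , refl , eq)
∈-steps⁻ a (x ∷ xs) (there d∈) with ∈-steps⁻ x xs d∈
-- The initial step of the tail starts at `x`, so in the whole list it joins positions 0 and 1.
... | inj₁ (k , k≡0 , eq)     = inj₂ (zero , suc k , cong suc k≡0 , eq)
... | inj₂ (j , k , k≡1+j , eq) = inj₂ (suc j , suc k , cong suc k≡1+j , eq)

-- Labels and edge differences of a spider with given arms.

module _ (arms : List (List ℕ)) where

  private
    f = labeling arms
    _⇒_ = Child (armLength arms)
    _~_ = SymClosure _⇒_

  labels-of-arm : ∀ {x} → Any (x ∈_) arms → ∃ λ v → x ≡ f v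
  labels-of-arm p = at (index p) (index q) , Any.lookup-index q
    where q = Any.lookup-index p

  labeling-injective : All (λ P → Unique P × ¬ 1 ∈ P) arms → AllPairs Disjoint arms →
                       ∀ {u v} → f u ≡ f v → u ≡ v
  labeling-injective good disj {hub} {hub} _ = refl
  labeling-injective good disj {hub} {at i j} eq =
    ⊥-elim (proj₂ (All.lookup good (∈-lookup i)) (subst (_∈ lookup arms i) (sym eq) (∈-lookup j)))
  labeling-injective good disj {at i j} {hub} eq =
    ⊥-elim (proj₂ (All.lookup good (∈-lookup i)) (subst (_∈ lookup arms i) eq (∈-lookup j)))
  labeling-injective good disj {at i j} {at i′ j′} eq
    -- Both arms contain the common label, hence they are the same arm, and its entries are
    -- distinct.
    with refl ← disjoint-lookup disj i i′ (∈-lookup j) (subst (_∈ lookup arms i′) (sym eq) (∈-lookup j′)) =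
    cong (at i) (lookup-injective (proj₁ (All.lookup good (∈-lookup i))) j j′ eq)

  Child-difference : ∀ {u v} → u ⇒ v → ∃ λ P → P ∈ arms × ∣ f u - f v ∣ ∈ steps 1 P
  Child-difference (first {i} {j} eq) = _ , ∈-lookup i , step-first 1 _ j eq
  Child-difference (next {i} {j} {k} eq) = _ , ∈-lookup i , step-next 1 _ j k eq

  -- Together with `step-edge`, this identifies the edge differences of the spider with the entries
  -- of `steps 1 P` for its arms `P`.
  edge-difference : ∀ {u v} → u ~ v → ∃ λ P → P ∈ arms × ∣ f u - f v ∣ ∈ steps 1 P
  edge-difference (fwd c) = Child-difference c
  edge-difference {u} {v} (bwd c) with P , P∈ , d∈ ← Child-difference c =
    P , P∈ , subst (_∈ steps 1 P) (∣-∣-comm (f v) (f u)) d∈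

  step-edge : ∀ {d} → Any (λ P → d ∈ steps 1 P) arms → ∃₂ λ u v → u ~ v × d ≡ ∣ f u - f v ∣
  step-edge p with ∈-steps⁻ 1 _ (Any.lookup-index p)
  ... | inj₁ (j , j≡0 , eq)       = hub , at _ j , fwd (first j≡0) , eq
  ... | inj₂ (j , k , k≡1+j , eq) = at _ j , at _ k , fwd (next k≡1+j) , eq

-- Arithmetic of `A n` and `τ`, and the resulting criterion for gracefulness.

∈-A⁺ : ∀ {n x} → x < n → x ≢ 1 → x ∈ A n
∈-A⁺ {x = zero}        _               _   = here refl
∈-A⁺ {x = suc zero}    _               x≢1 = ⊥-elim (x≢1 refl)
∈-A⁺ {x = suc (suc x)} (s≤s (s≤s x<n)) _   = there (∈-applyUpTo⁺ (λ k → suc (suc k)) x<n)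

∈-A⁻ : ∀ {n x} → 2 ≤ n → x ∈ A n → x < n × x ≢ 1
∈-A⁻ (s≤s (s≤s _)) (here refl) = s≤s z≤n , λ ()
∈-A⁻ (s≤s (s≤s _)) (there x∈) with _ , i<n , refl ← ∈-applyUpTo⁻ _ x∈ =
  s≤s (s≤s i<n) , λ ()

A-unique : ∀ n → Unique (A n)
A-unique n = All.applyUpTo⁺₂ _ _ (λ _ ()) ∷
  Unique.applyUpTo⁺₁ _ _ (λ i<j _ eq → <-irrefl (suc-injective (suc-injective eq)) i<j)

τ-bounds : ∀ {n x} → 2 ≤ n → x ∈ A n → 1 ≤ τ n x × τ n x ≤ n ∸ 1
τ-bounds {x = zero} (s≤s (s≤s _)) _ = s≤s z≤n , ≤-refl
-- The label 1 would give the forbidden difference 0.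
τ-bounds {x = suc zero} 2≤n x∈ = ⊥-elim (proj₂ (∈-A⁻ 2≤n x∈) refl)
τ-bounds {x = suc (suc x)} 2≤n@(s≤s (s≤s _)) x∈ = s≤s z≤n , s≤s⁻¹ (<⇒≤ (proj₁ (∈-A⁻ 2≤n x∈)))

-- The preimage of `d` is the label `d + 1`, except for the largest difference, where `d + 1` is no
-- longer a label and 0 takes its place.
τ-surjective : ∀ {n d} → 1 ≤ d → d ≤ n ∸ 1 → ∃ λ x → x ∈ A n × d ≡ τ n x
τ-surjective {suc n} {suc d} _ d≤n with suc d ≟ n
... | yes eq = 0 , here refl , eq
... | no neq = suc (suc d) , ∈-A⁺ (s≤s (≤∧≢⇒< d≤n neq)) (λ ()) , refl

-- Stated for arbitrary self-matched arms, so that the given legs and the attached leaves are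
-- treated alike.
graceful-spider : ∀ {n} → 2 ≤ n → (arms : List (List ℕ)) →
                  All (IsSelfMatchedLeg n) arms → AllPairs Disjoint arms →
                  (∀ {x} → x ∈ A n → Any (x ∈_) arms) →
                  IsGracefulLabeling (spider (armLength arms)) n (labeling arms)
graceful-spider {n} 2≤n@(s≤s (s≤s _)) arms legs disj cover = record
  { isTree      = spider-isTree
  ; injective   = labeling-injective arms (All.map good legs) disj
  ; labels      = (λ { (v , refl) → label-bound v }) , label-attained
  ; differences = difference-bounds , difference-attained
  }
  where
  open IsSelfMatchedLeg

  good : ∀ {P} → IsSelfMatchedLeg n P → Unique P × ¬ 1 ∈ P
  good leg = distinct leg , λ 1∈ → proj₂ (∈-A⁻ 2≤n (All.lookup (inA leg) 1∈)) refl

  label-bound : ∀ v → labeling arms v < n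
  label-bound hub      = 2≤n
  label-bound (at i j) =
    proj₁ (∈-A⁻ 2≤n (All.lookup (inA (All.lookup legs (∈-lookup i))) (∈-lookup j)))

  label-attained : ∀ {k} → k < n → ∃ λ v → k ≡ labeling arms v
  label-attained {k} k<n with k ≟ 1
  ... | yes refl = hub , refl
  ... | no k≢1   = labels-of-arm arms (cover (∈-A⁺ k<n k≢1))

  difference-bounds : ∀ {d} → (∃₂ λ u v → SymClosure (Child (armLength arms)) u v ×
                                  d ≡ ∣ labeling arms u - labeling arms v ∣) →
                      1 ≤ d × d ≤ n ∸ 1
  difference-bounds (u , v , u~v , refl)
    -- The edge lies on some arm `P`, and `selfMatched` trades its difference for `τ n x` with `x` a
    -- label of `P`.
    with P , P∈ , d∈ ← edge-difference arms u~v
    with leg ← All.lookup legs P∈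
    with x , x∈ , eq ← ∈-map⁻ (τ n) (Equivalence.to (selfMatched leg) d∈)
    rewrite eq = τ-bounds 2≤n (All.lookup (inA leg) x∈)

  difference-attained : ∀ {d} → 1 ≤ d × d ≤ n ∸ 1 →
                        ∃₂ λ u v → SymClosure (Child (armLength arms)) u v ×
                          d ≡ ∣ labeling arms u - labeling arms v ∣
  difference-attained (1≤d , d≤n∸1)
    -- Conversely, the arm carrying a preimage `x` of `d` has an edge with difference `d`, though
    -- that edge need not end at `x`.
    with x , x∈ , refl ← τ-surjective {n} 1≤d d≤n∸1
    with P , P∈ , x∈P ← find (cover x∈) =
    step-edge arms (lose P∈
      (Equivalence.from (selfMatched (All.lookup legs P∈)) (∈-map⁺ (τ n) x∈P)))

singleton-leg : ∀ {n x} → 2 ≤ n → x ∈ A n → x ≢ 0 → IsSelfMatchedLeg n [ x ]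
singleton-leg {x = zero}        _   _  x≢0 = ⊥-elim (x≢0 refl)
singleton-leg {x = suc zero}    2≤n x∈ _   = ⊥-elim (proj₂ (∈-A⁻ 2≤n x∈) refl)
singleton-leg {x = suc (suc x)} _   x∈ _   = record
  { distinct    = [] ∷ []
  ; inA         = x∈ ∷ []
  -- For the label `suc (suc x)` the only difference and the value of `τ` both compute to `suc x`,
  -- so the two lists agree definitionally.
  ; selfMatched = mk⇔ id id
  }

module _ (n : ℕ) (Ps : List (List ℕ)) where

  private
    unused? = λ x → ¬? (_∈?_ _≟_ x (concat Ps))

  ∈-unused⁻ : ∀ {x} → x ∈ unused n Ps → x ∈ A n × ¬ Any (x ∈_) Ps
  ∈-unused⁻ x∈ with x∈A , x∉ ← ∈-filter⁻ unused? {xs = A n} x∈ = x∈A , x∉ ∘ ∈-concat⁺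

  attach-cover : ∀ {x} → x ∈ A n → Any (x ∈_) (attach n Ps)
  attach-cover {x} x∈ with _∈?_ _≟_ x (concat Ps)
  ... | yes x∈Ps = Any.++⁺ˡ (∈-concat⁻ Ps x∈Ps)
  ... | no  x∉Ps = Any.++⁺ʳ Ps (Any.map⁺ (Any.map here (∈-filter⁺ unused? x∈ x∉Ps)))

  attach-disjoint : AllPairs Disjoint Ps → AllPairs Disjoint (attach n Ps)
  attach-disjoint disj = AllPairs.++⁺ disj
    -- Two leaves differ because `A n` has no repetitions.
    (AllPairs.map⁺ (AllPairs.map (λ { x≢y (here refl , here refl) → x≢y refl })
      (Unique.filter⁺ unused? (A-unique n))))
    (All.tabulate λ P∈ → All.map⁺ (All.tabulate λ x∈ → λ { (y∈P , here refl) →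
      proj₂ (∈-unused⁻ x∈) (Any.map (λ { refl → y∈P }) P∈) }))

  attach-legs : 2 ≤ n → Any (0 ∈_) Ps → All (IsSelfMatchedLeg n) Ps →
                All (IsSelfMatchedLeg n) (attach n Ps)
  attach-legs 2≤n 0∈ legs = All.++⁺ legs (All.map⁺ (All.tabulate λ x∈ →
    singleton-leg 2≤n (proj₁ (∈-unused⁻ x∈)) λ { refl → proj₂ (∈-unused⁻ x∈) 0∈ }))

theorem3p3 : (n : ℕ) → 2 ≤ n →
    (Ps : List (List ℕ)) →
    All (IsSelfMatchedLeg n) Ps →
    AllPairs Disjoint Ps →
    Any (λ P → 0 ∈ P) Ps →
    IsGracefulLabeling (spider (armLength (attach n Ps))) n (labeling (attach n Ps))
theorem3p3 n 2≤n Ps legs disj 0∈ = graceful-spider 2≤n (attach n Ps)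
  (attach-legs n Ps 2≤n 0∈ legs) (attach-disjoint n Ps disj) (attach-cover n Ps)
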